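{- On bipartite graphs, each of GVC, GVC1 and GVC2 is equivalent to the bipartite unconstrained 0-1 quadratic programming problem BQP01: every instance of one can be formulated as an instance of the other such that an optimal solution of the new instance yields an optimal solution of the original (identifying $U_1\subseteq V_1$, $U_2\subseteq V_2$ with incidence vectors $x\in\{0,1\}^m$, $y\in\{0,1\}^n$).
   Context: Let $G=(V_1,V_2,E)$ be a bipartite graph with $V_1=\{1,\dots,m\}$, $V_2=\{1,\dots,n\}$ and every edge $(i,j)$ having $i\in V_1$, $j\in V_2$. Vertices $i\in V_1$ have weights $c_i$, vertices $j\in V_2$ have weights $d_j$, and each edge has real weights $q^0_{ij},q^1_{ij},q^2_{ij}$. For $U_1\subseteq V_1$, $U_2\subseteq V_2$ let $E_0(U_1,U_2)=\{(i,j)\in E: i\notin U_1, j\notin U_2\}$, $E_1(U_1,U_2)$ the edges with exactly one of $i\in U_1$, $j\in U_2$, and $E_2(U_1,U_2)=\{(i,j)\in E: i\in U_1,j\in U_2\}$. GVC on $G$ minimizes $\sum_{i\in U_1}c_i+\sum_{j\in U_2}d_j+\sum_{E_0}q^0_{ij}+\sum_{E_1}q^1_{ij}+\sum_{E_2}q^2_{ij}$ over $U_1\subseteq V_1,U_2\subseteq V_2$; GVC1 is the special case $q^1\equiv q^2\equiv 0$; GVC2 is the special case $q^0\equiv q^1\equiv 0$. BQP01: given a real $m\times n$ matrix $Q=(q_{ij})$, $a\in\mathbb{R}^m$, $b\in\mathbb{R}^n$, minimize $\sum_i a_ix_i+\sum_j b_jy_j+\sum_{i,j}q_{ij}x_iy_j$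 over $x\in\{0,1\}^m$, $y\in\{0,1\}^n$. Two problems are equivalent if each can be formulated as the other so that an optimal solution of the formulated instance gives an optimal solution of the original. -}

module Defs where

open import Data.Bool.Base using (Bool; T)
open import Data.Bool.Properties using (T?)
open import Data.Digit using (Bit; 0b; 1b)
open import Data.Fin.Base using (Fin; zero; suc)
open import Data.Fin.Subset using (Subset; Side; inside; outside; _∈_; _∉_)
open import Data.Fin.Subset.Properties using (_∈?_)
open import Data.List.Base using (List; allFin; cartesianProduct; filter; foldr; map)
open import Data.Nat.Base as ℕ using (ℕ)
import Data.Nat.Properties as ℕ
open import Data.Product.Base using (Σ; ∃; _×_; _,_; proj₁; proj₂)
open import Data.Product.Function.NonDependent.Propositional using (_×-↔_)
open import Data.Rational.Base as ℚ using (ℚ; 0ℚ; 1ℚ; ½; ∣_∣)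
import Data.Rational.Properties as ℚ
open import Data.Rational.Solver using (module +-*-Solver)
open import Data.Sum.Base using (_⊎_)
open import Data.Vec.Base as Vec using (Vec)
import Data.Vec.Properties as Vec
open import Data.Vec.Functional using (Vector)
open import Function.Bundles using (_↔_; mk↔ₛ′; Inverse)
open import Level using (0ℓ)
open import Relation.Binary.PropositionalEquality
  using (_≡_; refl; sym; trans; cong; cong₂; subst)
open import Relation.Nullary.Decidable using (¬?; _×-dec_; _⊎-dec_)
open import Relation.Unary using (Pred)

------------------------------------------------------------------------
-- Real numbers: Cauchy sequences of rationals, with _≃_ as equality

IsCauchy : (ℕ → ℚ) → Set
IsCauchy x = ∀ ε → 0ℚ ℚ.< ε →
  ∃ λ N → ∀ k l → N ℕ.≤ k → N ℕ.≤ l → ∣ x k ℚ.- x l ∣ ℚ.< ε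

record ℝ : Set where
  constructor mkℝ
  field
    seq    : ℕ → ℚ
    cauchy : IsCauchy seq

open ℝ public

infix 4 _≃_ _≤_

_≃_ : ℝ → ℝ → Set
x ≃ y = ∀ ε → 0ℚ ℚ.< ε → ∃ λ N → ∀ k → N ℕ.≤ k → ∣ seq x k ℚ.- seq y k ∣ ℚ.< ε

_≤_ : ℝ → ℝ → Set
x ≤ y = ∀ ε → 0ℚ ℚ.< ε → ∃ λ N → ∀ k → N ℕ.≤ k → seq x k ℚ.< seq y k ℚ.+ ε

fromℚ : ℚ → ℝ
fromℚ p = mkℝ (λ _ → p) λ ε 0<ε → 0 , λ _ _ _ _ →
  subst (ℚ._< ε) (sym (cong ∣_∣ (ℚ.+-inverseʳ p))) 0<ε

0ℝ 1ℝ : ℝ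
0ℝ = fromℚ 0ℚ
1ℝ = fromℚ 1ℚ

module _ (x y : ℕ → ℚ) (x-cauchy : IsCauchy x) (y-cauchy : IsCauchy y) where
  open ℚ.≤-Reasoning

  +-cauchy : IsCauchy (λ k → x k ℚ.+ y k)
  +-cauchy ε 0<ε = Nx ℕ.⊔ Ny , λ k l N≤k N≤l → begin-strict
    ∣ (x k ℚ.+ y k) ℚ.- (x l ℚ.+ y l) ∣
      ≡⟨ cong ∣_∣ (rearrange (x k) (y k) (x l) (y l)) ⟩
    ∣ (x k ℚ.- x l) ℚ.+ (y k ℚ.- y l) ∣
      ≤⟨ ℚ.∣p+q∣≤∣p∣+∣q∣ (x k ℚ.- x l) (y k ℚ.- y l) ⟩
    ∣ x k ℚ.- x l ∣ ℚ.+ ∣ y k ℚ.- y l ∣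
      <⟨ ℚ.+-mono-< (x-close k l (x-late N≤k) (x-late N≤l))
                    (y-close k l (y-late N≤k) (y-late N≤l)) ⟩
    ½ ℚ.* ε ℚ.+ ½ ℚ.* ε
      ≡⟨ sym (ℚ.*-distribʳ-+ ε ½ ½) ⟩
    1ℚ ℚ.* ε
      ≡⟨ ℚ.*-identityˡ ε ⟩
    ε ∎
    where
    0<½ε : 0ℚ ℚ.< ½ ℚ.* ε
    0<½ε = subst (ℚ._< ½ ℚ.* ε) (ℚ.*-zeroʳ ½) (ℚ.*-monoʳ-<-pos ½ 0<ε)
    Nx = proj₁ (x-cauchy (½ ℚ.* ε) 0<½ε)
    Ny = proj₁ (y-cauchy (½ ℚ.* ε) 0<½ε)
    x-close = proj₂ (x-cauchy (½ ℚ.* ε) 0<½ε)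
    y-close = proj₂ (y-cauchy (½ ℚ.* ε) 0<½ε)
    x-late : ∀ {k} → Nx ℕ.⊔ Ny ℕ.≤ k → Nx ℕ.≤ k
    x-late = ℕ.≤-trans (ℕ.m≤m⊔n Nx Ny)
    y-late : ∀ {k} → Nx ℕ.⊔ Ny ℕ.≤ k → Ny ℕ.≤ k
    y-late = ℕ.≤-trans (ℕ.m≤n⊔m Nx Ny)
    rearrange : ∀ a b c d →
      (a ℚ.+ b) ℚ.- (c ℚ.+ d) ≡ (a ℚ.- c) ℚ.+ (b ℚ.- d)
    rearrange = solve 4 (λ a b c d →
      (a :+ b) :- (c :+ d) := (a :- c) :+ (b :- d)) refl
      where open +-*-Solver

eventually-bounded : ∀ x → IsCauchy x →
  ∃ λ B → 0ℚ ℚ.< B × ∃ λ N → ∀ k → N ℕ.≤ k → ∣ x k ∣ ℚ.≤ B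
eventually-bounded x x-cauchy = ∣ x N ∣ ℚ.+ 1ℚ , 0<B , N , λ k N≤k → begin
    ∣ x k ∣
      ≡⟨ cong ∣_∣ (split (x k) (x N)) ⟩
    ∣ x N ℚ.+ (x k ℚ.- x N) ∣
      ≤⟨ ℚ.∣p+q∣≤∣p∣+∣q∣ (x N) (x k ℚ.- x N) ⟩
    ∣ x N ∣ ℚ.+ ∣ x k ℚ.- x N ∣
      ≤⟨ ℚ.+-monoʳ-≤ ∣ x N ∣ (ℚ.<⇒≤ (close k N N≤k ℕ.≤-refl)) ⟩
    ∣ x N ∣ ℚ.+ 1ℚ ∎
  where
  open ℚ.≤-Reasoning
  0<1 : 0ℚ ℚ.< 1ℚ
  0<1 = ℚ.positive⁻¹ 1ℚ
  N = proj₁ (x-cauchy 1ℚ 0<1)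
  close = proj₂ (x-cauchy 1ℚ 0<1)
  0<B : 0ℚ ℚ.< ∣ x N ∣ ℚ.+ 1ℚ
  0<B = ℚ.+-mono-≤-< (ℚ.0≤∣p∣ (x N)) 0<1
  split : ∀ a b → a ≡ b ℚ.+ (a ℚ.- b)
  split = solve 2 (λ a b → a := b :+ (a :- b)) refl
    where open +-*-Solver

quotient : ∀ B ε → 0ℚ ℚ.< B → 0ℚ ℚ.< ε → ∃ λ δ → 0ℚ ℚ.< δ × B ℚ.* δ ≡ ε
quotient B ε 0<B 0<ε = B⁻¹ ℚ.* ε , 0<δ ,
  trans (sym (ℚ.*-assoc B B⁻¹ ε))
        (trans (cong (ℚ._* ε) (ℚ.*-inverseʳ B)) (ℚ.*-identityˡ ε))
  where
  instance
    B-positive = ℚ.positive 0<B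
    B-nonZero  = ℚ.pos⇒nonZero B
  B⁻¹ = ℚ.1/ B
  0<δ : 0ℚ ℚ.< B⁻¹ ℚ.* ε
  0<δ = subst (ℚ._< B⁻¹ ℚ.* ε) (ℚ.*-zeroʳ B⁻¹)
    (ℚ.*-monoʳ-<-pos B⁻¹ {{ℚ.1/pos⇒pos B}} 0<ε)

∣*∣-mono-≤-< : ∀ p q C δ → 0ℚ ℚ.< C → ∣ p ∣ ℚ.≤ C → ∣ q ∣ ℚ.< δ → ∣ p ℚ.* q ∣ ℚ.< C ℚ.* δ
∣*∣-mono-≤-< p q C δ 0<C p≤C q<δ = begin-strict
  ∣ p ℚ.* q ∣     ≡⟨ ℚ.∣p*q∣≡∣p∣*∣q∣ p q ⟩
  ∣ p ∣ ℚ.* ∣ q ∣ ≤⟨ ℚ.*-monoʳ-≤-nonNeg ∣ q ∣ {{ℚ.nonNegative (ℚ.0≤∣p∣ q)}} p≤C ⟩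
  C ℚ.* ∣ q ∣     <⟨ ℚ.*-monoʳ-<-pos C {{ℚ.positive 0<C}} q<δ ⟩
  C ℚ.* δ         ∎
  where open ℚ.≤-Reasoning

∣ab-cd∣< : ∀ a b c d B C δ → 0ℚ ℚ.< B → 0ℚ ℚ.< C → ∣ a ∣ ℚ.≤ B → ∣ d ∣ ℚ.≤ C →
  ∣ b ℚ.- d ∣ ℚ.< δ → ∣ a ℚ.- c ∣ ℚ.< δ →
  ∣ a ℚ.* b ℚ.- c ℚ.* d ∣ ℚ.< (B ℚ.+ C) ℚ.* δ
∣ab-cd∣< a b c d B C δ 0<B 0<C a≤B d≤C b-d<δ a-c<δ = begin-strict
  ∣ a ℚ.* b ℚ.- c ℚ.* d ∣
    ≡⟨ cong ∣_∣ (rearrange a b c d) ⟩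
  ∣ a ℚ.* (b ℚ.- d) ℚ.+ d ℚ.* (a ℚ.- c) ∣
    ≤⟨ ℚ.∣p+q∣≤∣p∣+∣q∣ (a ℚ.* (b ℚ.- d)) (d ℚ.* (a ℚ.- c)) ⟩
  ∣ a ℚ.* (b ℚ.- d) ∣ ℚ.+ ∣ d ℚ.* (a ℚ.- c) ∣
    <⟨ ℚ.+-mono-< (∣*∣-mono-≤-< a (b ℚ.- d) B δ 0<B a≤B b-d<δ)
                  (∣*∣-mono-≤-< d (a ℚ.- c) C δ 0<C d≤C a-c<δ) ⟩
  B ℚ.* δ ℚ.+ C ℚ.* δ
    ≡⟨ sym (ℚ.*-distribʳ-+ δ B C) ⟩
  (B ℚ.+ C) ℚ.* δ ∎
  where
  open ℚ.≤-Reasoning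
  rearrange : ∀ a b c d →
    a ℚ.* b ℚ.- c ℚ.* d ≡ a ℚ.* (b ℚ.- d) ℚ.+ d ℚ.* (a ℚ.- c)
  rearrange = solve 4 (λ a b c d →
    a :* b :- c :* d := a :* (b :- d) :+ d :* (a :- c)) refl
    where open +-*-Solver

*-cauchy : ∀ x y → IsCauchy x → IsCauchy y → IsCauchy (λ k → x k ℚ.* y k)
*-cauchy x y x-cauchy y-cauchy ε 0<ε =
  let Bx , 0<Bx , Mx , x≤Bx = eventually-bounded x x-cauchy
      By , 0<By , My , y≤By = eventually-bounded y y-cauchy
      δ , 0<δ , Bδ≡ε = quotient (Bx ℚ.+ By) ε (ℚ.+-mono-< 0<Bx 0<By) 0<ε
      Nx , x-close = x-cauchy δ 0<δ
      Ny , y-close = y-cauchy δ 0<δ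
  in (Mx ℕ.⊔ My) ℕ.⊔ (Nx ℕ.⊔ Ny) , λ k l N≤k N≤l →
    let M≤k  = ℕ.m⊔n≤o⇒m≤o (Mx ℕ.⊔ My) (Nx ℕ.⊔ Ny) N≤k
        M≤l  = ℕ.m⊔n≤o⇒m≤o (Mx ℕ.⊔ My) (Nx ℕ.⊔ Ny) N≤l
        N′≤k = ℕ.m⊔n≤o⇒n≤o (Mx ℕ.⊔ My) (Nx ℕ.⊔ Ny) N≤k
        N′≤l = ℕ.m⊔n≤o⇒n≤o (Mx ℕ.⊔ My) (Nx ℕ.⊔ Ny) N≤l
    in subst (∣ x k ℚ.* y k ℚ.- x l ℚ.* y l ∣ ℚ.<_) Bδ≡ε
      (∣ab-cd∣< (x k) (y k) (x l) (y l) Bx By δ 0<Bx 0<By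
        (x≤Bx k (ℕ.m⊔n≤o⇒m≤o Mx My M≤k))
        (y≤By l (ℕ.m⊔n≤o⇒n≤o Mx My M≤l))
        (y-close k l (ℕ.m⊔n≤o⇒n≤o Nx Ny N′≤k) (ℕ.m⊔n≤o⇒n≤o Nx Ny N′≤l))
        (x-close k l (ℕ.m⊔n≤o⇒m≤o Nx Ny N′≤k) (ℕ.m⊔n≤o⇒m≤o Nx Ny N′≤l)))

infixl 6 _+_
infixl 7 _*_

_+_ : ℝ → ℝ → ℝ
x + y = mkℝ (λ k → seq x k ℚ.+ seq y k) (+-cauchy (seq x) (seq y) (cauchy x) (cauchy y))

_*_ : ℝ → ℝ → ℝ
x * y = mkℝ (λ k → seq x k ℚ.* seq y k) (*-cauchy (seq x) (seq y) (cauchy x) (cauchy y))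

∑ : {A : Set} → List A → (A → ℝ) → ℝ
∑ xs f = foldr _+_ 0ℝ (map f xs)

infix 5 ∑
syntax ∑ xs (λ x → e) = ∑[ x ∈ xs ] e

------------------------------------------------------------------------
-- Minimization problems whose instances and solutions have dimensions m, n

record Problem : Set₁ where
  field
    Instance  : ℕ → ℕ → Set
    Solution  : ℕ → ℕ → Set
    objective : ∀ {m n} → Instance m n → Solution m n → ℝ

open Problem public

IsOptimal : (P : Problem) → ∀ {m n} → Instance P m n → Solution P m n → Set
IsOptimal P I s = ∀ t → objective P I s ≤ objective P I t

-- Every instance of P can be formulated as an instance of Q so that
-- `decode` sends optimal solutions of the latter to optimal solutions of
-- the former.
FormulableAs : (P Q : Problem) → (∀ {m n} → Solution Q m n → Solution P m n) → Set
FormulableAs P Q decode =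
  ∀ {m n} (I : Instance P m n) → ∃ λ (J : Instance Q m n) →
  ∀ s → IsOptimal Q J s → IsOptimal P I (decode s)

-- Equivalence of P and Q along a fixed identification of their solutions.
Equivalent : (P Q : Problem) → (∀ {m n} → Solution P m n ↔ Solution Q m n) → Set
Equivalent P Q φ =
  FormulableAs P Q (Inverse.from φ) × FormulableAs Q P (Inverse.to φ)

SpecialCase : (P : Problem) → (∀ {m n} → Pred (Instance P m n) 0ℓ) → Problem
SpecialCase P C = record
  { Instance  = λ m n → Σ (Instance P m n) C
  ; Solution  = Solution P
  ; objective = λ I → objective P (proj₁ I)
  }

------------------------------------------------------------------------
-- Generalized vertex cover on bipartite graphs

BipartiteGraph : ℕ → ℕ → Set
BipartiteGraph m n = Fin m → Fin n → Bool

module _ {m n : ℕ} (G : BipartiteGraph m n) where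

  edges : List (Fin m × Fin n)
  edges = filter (λ (i , j) → T? (G i j)) (cartesianProduct (allFin m) (allFin n))

  module _ (U₁ : Subset m) (U₂ : Subset n) where

    E₀ E₁ E₂ : List (Fin m × Fin n)
    E₀ = filter (λ (i , j) → ¬? (i ∈? U₁) ×-dec ¬? (j ∈? U₂)) edges
    E₁ = filter (λ (i , j) → ((i ∈? U₁) ×-dec ¬? (j ∈? U₂))
                       ⊎-dec (¬? (i ∈? U₁) ×-dec (j ∈? U₂))) edges
    E₂ = filter (λ (i , j) → (i ∈? U₁) ×-dec (j ∈? U₂)) edges

elements : ∀ {n} → Subset n → List (Fin n)
elements {n} U = filter (_∈? U) (allFin n)

-- Only the values of q⁰, q¹, q² on edges of the graph are meaningful.
record GVCInstance (m n : ℕ) : Set where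
  field
    graph    : BipartiteGraph m n
    c        : Vector ℝ m
    d        : Vector ℝ n
    q⁰ q¹ q² : Fin m → Fin n → ℝ

  VanishesOnEdges : (Fin m → Fin n → ℝ) → Set
  VanishesOnEdges q = ∀ i j → T (graph i j) → q i j ≃ 0ℝ

  cost : Subset m × Subset n → ℝ
  cost (U₁ , U₂) =
      (∑[ i ∈ elements U₁ ] c i)
    + (∑[ j ∈ elements U₂ ] d j)
    + (∑[ e ∈ E₀ graph U₁ U₂ ] q⁰ (proj₁ e) (proj₂ e))
    + (∑[ e ∈ E₁ graph U₁ U₂ ] q¹ (proj₁ e) (proj₂ e))
    + (∑[ e ∈ E₂ graph U₁ U₂ ] q² (proj₁ e) (proj₂ e))

GVC GVC1 GVC2 : Problem
GVC = record
  { Instance  = GVCInstance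
  ; Solution  = λ m n → Subset m × Subset n
  ; objective = GVCInstance.cost
  }
GVC1 = SpecialCase GVC λ I → let open GVCInstance I in
  VanishesOnEdges q¹ × VanishesOnEdges q²
GVC2 = SpecialCase GVC λ I → let open GVCInstance I in
  VanishesOnEdges q⁰ × VanishesOnEdges q¹

------------------------------------------------------------------------
-- Bipartite unconstrained 0-1 quadratic programming

fromBit : Bit → ℝ
fromBit zero       = 0ℝ
fromBit (suc zero) = 1ℝ

record BQP01Instance (m n : ℕ) : Set where
  field
    Q : Fin m → Fin n → ℝ
    a : Vector ℝ m
    b : Vector ℝ n

  value : Vec Bit m × Vec Bit n → ℝ
  value (xs , ys) =
      (∑[ i ∈ allFin m ] a i * x i)
    + (∑[ j ∈ allFin n ] b j * y j)
    + (∑[ i ∈ allFin m ] ∑[ j ∈ allFin n ] Q i j * x i * y j)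
    where
    x : Vector ℝ m
    x i = fromBit (Vec.lookup xs i)
    y : Vector ℝ n
    y j = fromBit (Vec.lookup ys j)

BQP01 : Problem
BQP01 = record
  { Instance  = BQP01Instance
  ; Solution  = λ m n → Vec Bit m × Vec Bit n
  ; objective = BQP01Instance.value
  }

------------------------------------------------------------------------
-- Subsets and their incidence vectors

toBit : Side → Bit
toBit inside  = 1b
toBit outside = 0b

toSide : Bit → Side
toSide zero       = outside
toSide (suc zero) = inside

incidence : ∀ {n} → Subset n ↔ Vec Bit n
incidence = mk↔ₛ′ (Vec.map toBit) (Vec.map toSide)
  (λ xs → trans (sym (Vec.map-∘ toBit toSide xs))
                (trans (Vec.map-cong to∘from xs) (Vec.map-id xs)))
  (λ U → trans (sym (Vec.map-∘ toSide toBit U))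
               (trans (Vec.map-cong from∘to U) (Vec.map-id U)))
  where
  to∘from : ∀ b → toBit (toSide b) ≡ b
  to∘from zero       = refl
  to∘from (suc zero) = refl
  from∘to : ∀ s → toSide (toBit s) ≡ s
  from∘to inside  = refl
  from∘to outside = refl

incidences : ∀ {m n} → (Subset m × Subset n) ↔ (Vec Bit m × Vec Bit n)
incidences = incidence ×-↔ incidence

{-# OPTIONS --safe #-}

-- The cost of an edge is a bilinear polynomial in the incidence bits x, y of its
-- endpoints:
--   q⁰(1 - x)(1 - y) + q¹(x(1 - y) + (1 - x)y) + q²xy
--     = q⁰ + (q¹ - q⁰)x + (q¹ - q⁰)y + (q⁰ - 2q¹ + q²)xy.
-- Summing over the edges, the GVC objective is a BQP01 objective plus a
-- constant, and a constant shift does not affect optimality. Conversely, on the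
-- complete bipartite graph any q⁰, q¹, q² with q⁰ - 2q¹ + q² = Q represent the
-- quadratic part of BQP01, and the vertex weights absorb the linear terms.
-- Since + and * on ℝ act termwise on the approximating sequences, all
-- identities hold exactly at each index k and are proved in ℚ.

module Submission where

open import Algebra.Bundles using (CommutativeRing)
import Algebra.Properties.Semiring.Sum as Sum
open import Data.Bool.Base using (Bool; true; false; not; _∧_; _∨_)
open import Data.Bool.Properties using (T?)
open import Data.Fin.Base using (Fin; zero; suc)
open import Data.Fin.Subset using (Subset; inside; outside)
open import Data.Fin.Subset.Properties using (_∈?_)
open import Data.List.Base using (List; []; _∷_; _++_; allFin; cartesianProduct; filter; map; tabulate)
open import Data.Nat.Base using (ℕ; zero; suc)
open import Data.Product.Base using (∃; _×_; _,_; proj₁; proj₂)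
open import Data.Rational.Base as ℚ using (ℚ; 0ℚ; 1ℚ)
import Data.Rational.Properties as ℚ
open import Data.Rational.Solver using (module +-*-Solver)
open import Data.Vec.Base as Vec using (_∷_)
open import Data.Vec.Functional using (Vector; replicate)
open import Function.Base using (_∘_)
open import Function.Bundles using (_↔_; Inverse)
open import Level using (0ℓ)
open import Relation.Binary.PropositionalEquality
  using (_≡_; refl; sym; trans; cong; cong₂; subst; subst₂; module ≡-Reasoning)
open import Relation.Nullary.Decidable using (does; ¬?; _×-dec_; _⊎-dec_)
open import Relation.Unary using (Pred; Decidable)

open import Defs

open Sum (CommutativeRing.semiring ℚ.+-*-commutativeRing)
  using (sum; sum-cong-≗; ∑-distrib-+; ∑-comm; *-distribʳ-sum; sum-replicate-zero)

-- Shifting an objective by a constant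

module _ (K : ℕ → ℚ) (x y x′ y′ : ℝ)
         (x-shift : ∀ k → seq x k ≡ K k ℚ.+ seq x′ k)
         (y-shift : ∀ k → seq y k ≡ K k ℚ.+ seq y′ k) where

  -- `_≤_` compares the sequences index by index, so the common term `K k` can be added at each `k`
  -- separately, and the threshold `N` stays the same. The converse adds `- K k`.
  ≤-shift⁺ : x′ ≤ y′ → x ≤ y
  ≤-shift⁺ x′≤y′ ε 0<ε = let N , p = x′≤y′ ε 0<ε in N , λ k N≤k →
    subst₂ ℚ._<_ (sym (x-shift k))
      (trans (sym (ℚ.+-assoc (K k) (seq y′ k) ε)) (cong (ℚ._+ ε) (sym (y-shift k))))
      (ℚ.+-monoʳ-< (K k) (p k N≤k))

  ≤-shift⁻ : x ≤ y → x′ ≤ y′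
  ≤-shift⁻ x≤y ε 0<ε = let N , p = x≤y ε 0<ε in N , λ k N≤k →
    subst₂ ℚ._<_
      (trans (cong (ℚ.- K k ℚ.+_) (x-shift k)) (cancel (K k) (seq x′ k)))
      (trans (cong (λ z → ℚ.- K k ℚ.+ (z ℚ.+ ε)) (y-shift k)) (cancel-+ (K k) (seq y′ k) ε))
      (ℚ.+-monoʳ-< (ℚ.- K k) (p k N≤k))
    where
    open +-*-Solver
    cancel : ∀ a b → ℚ.- a ℚ.+ (a ℚ.+ b) ≡ b
    cancel = solve 2 (λ a b → :- a :+ (a :+ b) := b) refl
    cancel-+ : ∀ a b c → ℚ.- a ℚ.+ (a ℚ.+ b ℚ.+ c) ≡ b ℚ.+ c
    cancel-+ = solve 3 (λ a b c → :- a :+ (a :+ b :+ c) := b :+ c) refl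

module _ {P Q : Problem} {m n : ℕ} (φ : Solution P m n ↔ Solution Q m n)
         (I : Instance P m n) (J : Instance Q m n) (K : ℕ → ℚ)
         (shift : ∀ s k → seq (objective P I s) k ≡ K k ℚ.+ seq (objective Q J (Inverse.to φ s)) k)
         where
  open Inverse φ using (strictlyInverseˡ)

  from-optimal : ∀ s → IsOptimal Q J s → IsOptimal P I (Inverse.from φ s)
  from-optimal s opt t = ≤-shift⁺ K
    (objective P I (Inverse.from φ s)) (objective P I t)
    (objective Q J (Inverse.to φ (Inverse.from φ s))) (objective Q J (Inverse.to φ t))
    (shift (Inverse.from φ s)) (shift t)
    (subst (λ u → objective Q J u ≤ objective Q J (Inverse.to φ t)) (sym (strictlyInverseˡ s))
      (opt (Inverse.to φ t)))

  -- A competitor `t` for `J` is the image of `Inverse.from φ t`, so it suffices to test optimality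
  -- against preimages.
  to-optimal : ∀ s → IsOptimal P I s → IsOptimal Q J (Inverse.to φ s)
  to-optimal s opt t = subst (λ u → objective Q J (Inverse.to φ s) ≤ objective Q J u)
    (strictlyInverseˡ t)
    (≤-shift⁻ K
      (objective P I s) (objective P I (Inverse.from φ t))
      (objective Q J (Inverse.to φ s)) (objective Q J (Inverse.to φ (Inverse.from φ t)))
      (shift s) (shift (Inverse.from φ t)) (opt (Inverse.from φ t)))

-- Sums over lists as iterated sums of rationals

𝟙 : Bool → ℚ
𝟙 true  = 1ℚ
𝟙 false = 0ℚ

listSum : {A : Set} → List A → (A → ℚ) → ℚ
listSum []       f = 0ℚ
listSum (x ∷ xs) f = f x ℚ.+ listSum xs f

seq-∑ : {A : Set} (xs : List A) (f : A → ℝ) → ∀ k →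
  seq (∑ xs f) k ≡ listSum xs (λ x → seq (f x) k)
seq-∑ []       f k = refl
seq-∑ (x ∷ xs) f k = cong (seq (f x) k ℚ.+_) (seq-∑ xs f k)

listSum-allFin : ∀ {n} (f : Fin n → ℚ) → listSum (allFin n) f ≡ sum f
listSum-allFin f = listSum-tabulate (λ i → i)
  where
  -- `allFin` is `tabulate` of the identity; the induction replaces `g` by `g ∘ suc`, hence the
  -- general `g`.
  listSum-tabulate : ∀ {n} (g : Fin n → _) → listSum (tabulate g) f ≡ sum (f ∘ g)
  listSum-tabulate {zero}  g = refl
  listSum-tabulate {suc n} g = cong (f (g zero) ℚ.+_) (listSum-tabulate (g ∘ suc))

-- With weights in place of filters, the index set no longer depends on the chosen subsets, so the
-- three edge sums can later be added term by term.
listSum-filter : {A : Set} {P : Pred A 0ℓ} (P? : Decidable P) (xs : List A) (f : A → ℚ) →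
  listSum (filter P? xs) f ≡ listSum xs (λ x → 𝟙 (does (P? x)) ℚ.* f x)
listSum-filter P? []       f = refl
listSum-filter P? (x ∷ xs) f with does (P? x)
... | true  = cong₂ ℚ._+_ (sym (ℚ.*-identityˡ (f x))) (listSum-filter P? xs f)
... | false = trans (listSum-filter P? xs f)
  (trans (sym (ℚ.+-identityˡ _)) (cong (ℚ._+ _) (sym (ℚ.*-zeroˡ (f x)))))

listSum-cartesianProduct : {A B : Set} (xs : List A) (ys : List B) (f : A × B → ℚ) →
  listSum (cartesianProduct xs ys) f ≡ listSum xs (λ x → listSum ys (λ y → f (x , y)))
listSum-cartesianProduct []       ys f = refl
listSum-cartesianProduct (x ∷ xs) ys f = trans (listSum-row ys)
  (cong (listSum ys (λ y → f (x , y)) ℚ.+_) (listSum-cartesianProduct xs ys f))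
  where
  rest = cartesianProduct xs ys
  -- The induction consumes one row only, while `rest` must keep the full `ys`.
  listSum-row : ∀ zs → listSum (map (x ,_) zs ++ rest) f
                     ≡ listSum zs (λ y → f (x , y)) ℚ.+ listSum rest f
  listSum-row []       = sym (ℚ.+-identityˡ _)
  listSum-row (y ∷ zs) = trans (cong (f (x , y) ℚ.+_) (listSum-row zs))
    (sym (ℚ.+-assoc (f (x , y)) _ _))

-- Double sums and sums over vertices and edges

sum² : ∀ {m n} → (Fin m → Fin n → ℚ) → ℚ
sum² f = sum (λ i → sum (f i))

sum²-cong : ∀ {m n} {f g : Fin m → Fin n → ℚ} → (∀ i j → f i j ≡ g i j) → sum² f ≡ sum² g
sum²-cong f≗g = sum-cong-≗ λ i → sum-cong-≗ (f≗g i)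

sum²-distrib-+ : ∀ {m n} (f g : Fin m → Fin n → ℚ) →
  sum² (λ i j → f i j ℚ.+ g i j) ≡ sum² f ℚ.+ sum² g
sum²-distrib-+ f g =
  trans (sum-cong-≗ λ i → ∑-distrib-+ (f i) (g i)) (∑-distrib-+ (λ i → sum (f i)) (λ i → sum (g i)))

seq-∑-allFin : ∀ {n} (f : Fin n → ℝ) k →
  seq (∑[ i ∈ allFin n ] f i) k ≡ sum (λ i → seq (f i) k)
seq-∑-allFin f k = trans (seq-∑ (allFin _) f k) (listSum-allFin (λ i → seq (f i) k))

seq-∑-allFin² : ∀ {m n} (f : Fin m → Fin n → ℝ) k →
  seq (∑[ i ∈ allFin m ] ∑[ j ∈ allFin n ] f i j) k ≡ sum² (λ i j → seq (f i j) k)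
seq-∑-allFin² {n = n} f k =
  trans (seq-∑-allFin (λ i → ∑ (allFin n) (f i)) k) (sum-cong-≗ λ i → seq-∑-allFin (f i) k)

seq-∑-elements : ∀ {n} (U : Subset n) (f : Fin n → ℝ) k →
  seq (∑[ i ∈ elements U ] f i) k ≡ sum (λ i → 𝟙 (does (i ∈? U)) ℚ.* seq (f i) k)
seq-∑-elements U f k =
  trans (seq-∑ (elements U) f k)
  (trans (listSum-filter (_∈? U) (allFin _) (λ i → seq (f i) k))
         (listSum-allFin (λ i → 𝟙 (does (i ∈? U)) ℚ.* seq (f i) k)))

listSum-edges : ∀ {m n} (G : BipartiteGraph m n) {P : Pred (Fin m × Fin n) 0ℓ} (P? : Decidable P)
  (q : Fin m × Fin n → ℚ) →
  listSum (filter P? (edges G)) q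
    ≡ sum² (λ i j → 𝟙 (G i j) ℚ.* (𝟙 (does (P? (i , j))) ℚ.* q (i , j)))
listSum-edges {m} {n} G P? q =
  trans (listSum-filter P? (edges G) q)
  (trans (listSum-filter (λ (i , j) → T? (G i j)) (cartesianProduct (allFin m) (allFin n)) q′)
  (trans (listSum-cartesianProduct (allFin m) (allFin n) q″)
  (trans (listSum-allFin (λ i → listSum (allFin n) (λ j → q″ (i , j))))
         (sum-cong-≗ λ i → listSum-allFin (λ j → q″ (i , j))))))
  where
  q′ q″ : Fin m × Fin n → ℚ
  q′ e = 𝟙 (does (P? e)) ℚ.* q e
  q″ (i , j) = 𝟙 (G i j) ℚ.* q′ (i , j)

seq-∑-edges : ∀ {m n} (G : BipartiteGraph m n) {P : Pred (Fin m × Fin n) 0ℓ} (P? : Decidable P)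
  (q : Fin m → Fin n → ℝ) k →
  seq (∑[ e ∈ filter P? (edges G) ] q (proj₁ e) (proj₂ e)) k
    ≡ sum² (λ i j → 𝟙 (G i j) ℚ.* (𝟙 (does (P? (i , j))) ℚ.* seq (q i j) k))
seq-∑-edges G P? q k =
  trans (seq-∑ (filter P? (edges G)) (λ e → q (proj₁ e) (proj₂ e)) k)
        (listSum-edges G P? (λ e → seq (q (proj₁ e) (proj₂ e)) k))

-- `0ℝ` and `1ℝ` are constant sequences, so the bit has the same rational value at every index.
seq-incidence : ∀ {n} (U : Subset n) i k →
  seq (fromBit (Vec.lookup (Vec.map toBit U) i)) k ≡ 𝟙 (does (i ∈? U))
seq-incidence (inside  ∷ U) zero    k = refl
seq-incidence (outside ∷ U) zero    k = refl
seq-incidence (s       ∷ U) (suc i) k = seq-incidence U i k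

-- The objectives at a fixed index

bilinear : ∀ {m n} → Vector ℚ m → Vector ℚ n → (Fin m → Fin n → ℚ) → Vector ℚ m → Vector ℚ n → ℚ
bilinear a b Q x y =
  sum (λ i → a i ℚ.* x i) ℚ.+ sum (λ j → b j ℚ.* y j) ℚ.+ sum² (λ i j → Q i j ℚ.* x i ℚ.* y j)

module _ {m n : ℕ} where

  bilinear-cong : {a a′ : Vector ℚ m} {b b′ : Vector ℚ n} {Q Q′ : Fin m → Fin n → ℚ} →
    (∀ i → a i ≡ a′ i) → (∀ j → b j ≡ b′ j) → (∀ i j → Q i j ≡ Q′ i j) →
    ∀ x y → bilinear a b Q x y ≡ bilinear a′ b′ Q′ x y
  bilinear-cong a≗ b≗ Q≗ x y = cong₂ ℚ._+_
    (cong₂ ℚ._+_ (sum-cong-≗ λ i → cong (ℚ._* x i) (a≗ i)) (sum-cong-≗ λ j → cong (ℚ._* y j) (b≗ j)))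
    (sum²-cong λ i j → cong (λ q → q ℚ.* x i ℚ.* y j) (Q≗ i j))

  seq-value : (B : BQP01Instance m n) (U₁ : Subset m) (U₂ : Subset n) → let open BQP01Instance B in
    ∀ k → seq (objective BQP01 B (Inverse.to incidences (U₁ , U₂))) k
        ≡ bilinear (λ i → seq (a i) k) (λ j → seq (b j) k) (λ i j → seq (Q i j) k)
                   (λ i → 𝟙 (does (i ∈? U₁))) (λ j → 𝟙 (does (j ∈? U₂)))
  seq-value B U₁ U₂ k = cong₂ ℚ._+_
    (cong₂ ℚ._+_
      (trans (seq-∑-allFin {m} _ k)
             (sum-cong-≗ λ i → cong (seq (a i) k ℚ.*_) (seq-incidence U₁ i k)))
      (trans (seq-∑-allFin {n} _ k)
             (sum-cong-≗ λ j → cong (seq (b j) k ℚ.*_) (seq-incidence U₂ j k))))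
    (trans (seq-∑-allFin² {m} {n} _ k) (sum²-cong λ i j →
      cong₂ (λ p q → seq (Q i j) k ℚ.* p ℚ.* q) (seq-incidence U₁ i k) (seq-incidence U₂ j k)))
    where open BQP01Instance B

  -- The Boolean weights are what `does` computes to on the composite deciders that define `E₀`,
  -- `E₁` and `E₂`.
  seq-cost : (I : GVCInstance m n) (U₁ : Subset m) (U₂ : Subset n) → let open GVCInstance I in
    ∀ k → seq (cost (U₁ , U₂)) k
        ≡ sum (λ i → 𝟙 (does (i ∈? U₁)) ℚ.* seq (c i) k)
          ℚ.+ sum (λ j → 𝟙 (does (j ∈? U₂)) ℚ.* seq (d j) k)
          ℚ.+ sum² (λ i j → 𝟙 (graph i j)
                ℚ.* (𝟙 (not (does (i ∈? U₁)) ∧ not (does (j ∈? U₂))) ℚ.* seq (q⁰ i j) k))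
          ℚ.+ sum² (λ i j → 𝟙 (graph i j)
                ℚ.* (𝟙 ((does (i ∈? U₁) ∧ not (does (j ∈? U₂)))
                      ∨ (not (does (i ∈? U₁)) ∧ does (j ∈? U₂))) ℚ.* seq (q¹ i j) k))
          ℚ.+ sum² (λ i j → 𝟙 (graph i j)
                ℚ.* (𝟙 (does (i ∈? U₁) ∧ does (j ∈? U₂)) ℚ.* seq (q² i j) k))
  seq-cost I U₁ U₂ k =
    cong₂ ℚ._+_ (cong₂ ℚ._+_ (cong₂ ℚ._+_ (cong₂ ℚ._+_
      (seq-∑-elements U₁ c k)
      (seq-∑-elements U₂ d k))
      (seq-∑-edges graph (λ (i , j) → ¬? (i ∈? U₁) ×-dec ¬? (j ∈? U₂)) q⁰ k))
      (seq-∑-edges graph (λ (i , j) → ((i ∈? U₁) ×-dec ¬? (j ∈? U₂))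
                                ⊎-dec (¬? (i ∈? U₁) ×-dec (j ∈? U₂))) q¹ k))
      (seq-∑-edges graph (λ (i , j) → (i ∈? U₁) ×-dec (j ∈? U₂)) q² k)
    where open GVCInstance I

-- Here `g` is the indicator of the edge. Differences are spelled as `p + -1 * q`, and the quadratic
-- coefficient as a sum of two differences, to agree definitionally with the terms of the real
-- coefficients in `toBQP01`.
edge-cost : ∀ x y g q⁰ q¹ q² →
  g ℚ.* (𝟙 (not x ∧ not y) ℚ.* q⁰) ℚ.+ g ℚ.* (𝟙 ((x ∧ not y) ∨ (not x ∧ y)) ℚ.* q¹)
    ℚ.+ g ℚ.* (𝟙 (x ∧ y) ℚ.* q²)
  ≡ g ℚ.* q⁰ ℚ.+ g ℚ.* (q¹ ℚ.+ ℚ.- 1ℚ ℚ.* q⁰) ℚ.* 𝟙 x ℚ.+ g ℚ.* (q¹ ℚ.+ ℚ.- 1ℚ ℚ.* q⁰) ℚ.* 𝟙 y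
    ℚ.+ g ℚ.* ((q⁰ ℚ.+ ℚ.- 1ℚ ℚ.* q¹) ℚ.+ (q² ℚ.+ ℚ.- 1ℚ ℚ.* q¹)) ℚ.* 𝟙 x ℚ.* 𝟙 y
edge-cost x y g q⁰ q¹ q² = trans
  (cong₂ ℚ._+_ (cong₂ ℚ._+_ (cong (λ z → g ℚ.* (z ℚ.* q⁰)) (none x y))
                            (cong (λ z → g ℚ.* (z ℚ.* q¹)) (one x y)))
               (cong (λ z → g ℚ.* (z ℚ.* q²)) (both x y)))
  (expand (𝟙 x) (𝟙 y) g q⁰ q¹ q²)
  where
  -- Each Boolean test equals a polynomial in the bits on all four assignments. What remains is a
  -- ring identity valid for arbitrary rationals.
  none : ∀ x y → 𝟙 (not x ∧ not y) ≡ (1ℚ ℚ.- 𝟙 x) ℚ.* (1ℚ ℚ.- 𝟙 y)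
  none true  true  = refl
  none true  false = refl
  none false true  = refl
  none false false = refl
  one : ∀ x y → 𝟙 ((x ∧ not y) ∨ (not x ∧ y)) ≡ 𝟙 x ℚ.* (1ℚ ℚ.- 𝟙 y) ℚ.+ (1ℚ ℚ.- 𝟙 x) ℚ.* 𝟙 y
  one true  true  = refl
  one true  false = refl
  one false true  = refl
  one false false = refl
  both : ∀ x y → 𝟙 (x ∧ y) ≡ 𝟙 x ℚ.* 𝟙 y
  both true  true  = refl
  both true  false = refl
  both false true  = refl
  both false false = refl
  open +-*-Solver
  expand : ∀ x y g q⁰ q¹ q² →
    g ℚ.* ((1ℚ ℚ.- x) ℚ.* (1ℚ ℚ.- y) ℚ.* q⁰)
      ℚ.+ g ℚ.* ((x ℚ.* (1ℚ ℚ.- y) ℚ.+ (1ℚ ℚ.- x) ℚ.* y) ℚ.* q¹)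
      ℚ.+ g ℚ.* (x ℚ.* y ℚ.* q²)
    ≡ g ℚ.* q⁰ ℚ.+ g ℚ.* (q¹ ℚ.+ ℚ.- 1ℚ ℚ.* q⁰) ℚ.* x ℚ.+ g ℚ.* (q¹ ℚ.+ ℚ.- 1ℚ ℚ.* q⁰) ℚ.* y
      ℚ.+ g ℚ.* ((q⁰ ℚ.+ ℚ.- 1ℚ ℚ.* q¹) ℚ.+ (q² ℚ.+ ℚ.- 1ℚ ℚ.* q¹)) ℚ.* x ℚ.* y
  expand = solve 6 (λ x y g q⁰ q¹ q² → let 1# = con 1ℚ; -1# = con (ℚ.- 1ℚ) in
    g :* ((1# :- x) :* (1# :- y) :* q⁰)
      :+ g :* ((x :* (1# :- y) :+ (1# :- x) :* y) :* q¹)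
      :+ g :* (x :* y :* q²)
    := g :* q⁰ :+ g :* (q¹ :+ -1# :* q⁰) :* x :+ g :* (q¹ :+ -1# :* q⁰) :* y
      :+ g :* ((q⁰ :+ -1# :* q¹) :+ (q² :+ -1# :* q¹)) :* x :* y) refl

module _ {m n : ℕ} (c : Vector ℚ m) (d : Vector ℚ n) (f₀ f₁ f₂ κ ρ Q : Fin m → Fin n → ℚ)
         (x : Vector ℚ m) (y : Vector ℚ n)
         (expansion : ∀ i j → f₀ i j ℚ.+ f₁ i j ℚ.+ f₂ i j
                            ≡ κ i j ℚ.+ ρ i j ℚ.* x i ℚ.+ ρ i j ℚ.* y j ℚ.+ Q i j ℚ.* x i ℚ.* y j)
         where
  open ≡-Reasoning

  -- The edge cost is symmetric in its endpoints up to the choice of variable, so one `ρ` serves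
  -- both linear terms: its row sums join the weights `c` and its column sums join `d`.
  collect-bilinear :
    sum (λ i → x i ℚ.* c i) ℚ.+ sum (λ j → y j ℚ.* d j) ℚ.+ sum² f₀ ℚ.+ sum² f₁ ℚ.+ sum² f₂
    ≡ sum² κ ℚ.+ bilinear (λ i → c i ℚ.+ sum (ρ i)) (λ j → d j ℚ.+ sum (λ i → ρ i j)) Q x y
  collect-bilinear = begin
    X ℚ.+ Y ℚ.+ sum² f₀ ℚ.+ sum² f₁ ℚ.+ sum² f₂
      ≡⟨ assoc X Y (sum² f₀) (sum² f₁) (sum² f₂) ⟩
    X ℚ.+ Y ℚ.+ (sum² f₀ ℚ.+ sum² f₁ ℚ.+ sum² f₂)
      ≡⟨ cong (X ℚ.+ Y ℚ.+_) edge-sum ⟩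
    X ℚ.+ Y ℚ.+ (sum² κ ℚ.+ R₁ ℚ.+ R₂ ℚ.+ S)
      ≡⟨ rearrange X Y (sum² κ) R₁ R₂ S ⟩
    sum² κ ℚ.+ ((X ℚ.+ R₁) ℚ.+ (Y ℚ.+ R₂) ℚ.+ S)
      ≡⟨ cong₂ (λ p q → sum² κ ℚ.+ (p ℚ.+ q ℚ.+ S)) (absorb x c ρ)
           -- Exchanging the order of summation lets `absorb` act on the transpose of `ρ`.
           (trans (cong (Y ℚ.+_) (∑-comm (λ i j → ρ i j ℚ.* y j))) (absorb y d (λ j i → ρ i j))) ⟩
    sum² κ ℚ.+ bilinear (λ i → c i ℚ.+ sum (ρ i)) (λ j → d j ℚ.+ sum (λ i → ρ i j)) Q x y ∎
    where
    X = sum (λ i → x i ℚ.* c i)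
    Y = sum (λ j → y j ℚ.* d j)
    R₁ = sum² (λ i j → ρ i j ℚ.* x i)
    R₂ = sum² (λ i j → ρ i j ℚ.* y j)
    S = sum² (λ i j → Q i j ℚ.* x i ℚ.* y j)

    edge-sum : sum² f₀ ℚ.+ sum² f₁ ℚ.+ sum² f₂ ≡ sum² κ ℚ.+ R₁ ℚ.+ R₂ ℚ.+ S
    edge-sum = begin
      sum² f₀ ℚ.+ sum² f₁ ℚ.+ sum² f₂
        ≡⟨ cong (ℚ._+ sum² f₂) (sum²-distrib-+ f₀ f₁) ⟨
      sum² (λ i j → f₀ i j ℚ.+ f₁ i j) ℚ.+ sum² f₂
        ≡⟨ sum²-distrib-+ _ f₂ ⟨
      sum² (λ i j → f₀ i j ℚ.+ f₁ i j ℚ.+ f₂ i j)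
        ≡⟨ sum²-cong expansion ⟩
      sum² (λ i j → κ i j ℚ.+ ρ i j ℚ.* x i ℚ.+ ρ i j ℚ.* y j ℚ.+ Q i j ℚ.* x i ℚ.* y j)
        ≡⟨ sum²-distrib-+ _ (λ i j → Q i j ℚ.* x i ℚ.* y j) ⟩
      sum² (λ i j → κ i j ℚ.+ ρ i j ℚ.* x i ℚ.+ ρ i j ℚ.* y j) ℚ.+ S
        ≡⟨ cong (ℚ._+ S) (sum²-distrib-+ _ (λ i j → ρ i j ℚ.* y j)) ⟩
      sum² (λ i j → κ i j ℚ.+ ρ i j ℚ.* x i) ℚ.+ R₂ ℚ.+ S
        ≡⟨ cong (λ z → z ℚ.+ R₂ ℚ.+ S) (sum²-distrib-+ κ (λ i j → ρ i j ℚ.* x i)) ⟩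
      sum² κ ℚ.+ R₁ ℚ.+ R₂ ℚ.+ S ∎

    absorb : ∀ {m n} (x c : Vector ℚ m) (ρ : Fin m → Fin n → ℚ) →
      sum (λ i → x i ℚ.* c i) ℚ.+ sum² (λ i j → ρ i j ℚ.* x i)
      ≡ sum (λ i → (c i ℚ.+ sum (ρ i)) ℚ.* x i)
    absorb x c ρ = trans (sym (∑-distrib-+ (λ i → x i ℚ.* c i) _)) (sum-cong-≗ λ i →
      trans (cong₂ ℚ._+_ (ℚ.*-comm (x i) (c i)) (sym (*-distribʳ-sum (x i) (ρ i))))
            (sym (ℚ.*-distribʳ-+ (x i) (c i) (sum (ρ i)))))

    open +-*-Solver
    assoc : ∀ a b c d e → a ℚ.+ b ℚ.+ c ℚ.+ d ℚ.+ e ≡ a ℚ.+ b ℚ.+ (c ℚ.+ d ℚ.+ e)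
    assoc = solve 5 (λ a b c d e → a :+ b :+ c :+ d :+ e := a :+ b :+ (c :+ d :+ e)) refl
    rearrange : ∀ a b c d e f →
      a ℚ.+ b ℚ.+ (c ℚ.+ d ℚ.+ e ℚ.+ f) ≡ c ℚ.+ ((a ℚ.+ d) ℚ.+ (b ℚ.+ e) ℚ.+ f)
    rearrange = solve 6 (λ a b c d e f →
      a :+ b :+ (c :+ d :+ e :+ f) := c :+ ((a :+ d) :+ (b :+ e) :+ f)) refl

-- The two reformulations

infixl 6 _-_

-- Built from `_+_` and `_*_`, so the Cauchy property is inherited and every term unfolds to the
-- form used in `edge-cost`.
_-_ : ℝ → ℝ → ℝ
x - y = x + fromℚ (ℚ.- 1ℚ) * y

module _ {m n : ℕ} where

  toBQP01 : GVCInstance m n → BQP01Instance m n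
  toBQP01 I = record
    { Q = λ i j → edge i j * ((q⁰ i j - q¹ i j) + (q² i j - q¹ i j))
    ; a = λ i → c i + (∑[ j ∈ allFin n ] edge i j * (q¹ i j - q⁰ i j))
    ; b = λ j → d j + (∑[ i ∈ allFin m ] edge i j * (q¹ i j - q⁰ i j))
    }
    where
    open GVCInstance I
    -- Weights on non-edges are arbitrary; the factor 0 removes them.
    edge : Fin m → Fin n → ℝ
    edge i j = fromℚ (𝟙 (graph i j))

  -- This is the cost of choosing both subsets empty, when every edge lies in `E₀`.
  offset : GVCInstance m n → ℕ → ℚ
  offset I k = sum² (λ i j → 𝟙 (graph i j) ℚ.* seq (q⁰ i j) k)
    where open GVCInstance I

  cost-toBQP01 : ∀ I s k → seq (objective GVC I s) k
    ≡ offset I k ℚ.+ seq (objective BQP01 (toBQP01 I) (Inverse.to incidences s)) k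
  cost-toBQP01 I (U₁ , U₂) k =
    trans (seq-cost I U₁ U₂ k)
    (trans (collect-bilinear (λ i → seq (c i) k) (λ j → seq (d j) k) _ _ _ κ ρ Q x y
             (λ i j → edge-cost (does (i ∈? U₁)) (does (j ∈? U₂)) (𝟙 (graph i j))
                                (seq (q⁰ i j) k) (seq (q¹ i j) k) (seq (q² i j) k)))
           (cong (offset I k ℚ.+_) (trans
             -- Only the row and column sums inside the vertex weights need converting from list
             -- sums; the quadratic coefficients agree definitionally.
             (bilinear-cong {Q = Q} {Q′ = Q}
               (λ i → cong (seq (c i) k ℚ.+_) (sym (seq-∑-allFin {n} _ k)))
               (λ j → cong (seq (d j) k ℚ.+_) (sym (seq-∑-allFin {m} _ k)))
               (λ i j → refl) x y)
             (sym (seq-value (toBQP01 I) U₁ U₂ k)))))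
    where
    open GVCInstance I
    x : Vector ℚ m
    x i = 𝟙 (does (i ∈? U₁))
    y : Vector ℚ n
    y j = 𝟙 (does (j ∈? U₂))
    κ ρ Q : Fin m → Fin n → ℚ
    κ i j = 𝟙 (graph i j) ℚ.* seq (q⁰ i j) k
    ρ i j = 𝟙 (graph i j) ℚ.* seq (q¹ i j - q⁰ i j) k
    Q i j = 𝟙 (graph i j) ℚ.* seq ((q⁰ i j - q¹ i j) + (q² i j - q¹ i j)) k

  module _ (B : BQP01Instance m n) (q⁰ q¹ q² : Fin m → Fin n → ℝ) where
    open BQP01Instance B

    -- Expanding the edge costs creates linear coefficients `q¹ - q⁰`; the vertex weights contain
    -- their negatives in advance, so that only `a` and `b` survive. Completeness of the graph gives
    -- every matrix entry its edge.
    completeGVC : GVCInstance m n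
    completeGVC = record
      { graph = λ _ _ → true
      ; c     = λ i → a i + (∑[ j ∈ allFin n ] q⁰ i j - q¹ i j)
      ; d     = λ j → b j + (∑[ i ∈ allFin m ] q⁰ i j - q¹ i j)
      ; q⁰    = q⁰
      ; q¹    = q¹
      ; q²    = q²
      }

    module _ (splits : ∀ i j k → seq ((q⁰ i j - q¹ i j) + (q² i j - q¹ i j)) k ≡ seq (Q i j) k) where

      -- The forward computation is reused: `toBQP01` applied to `completeGVC` gives back the
      -- coefficients of `B` at every index, by cancellation in the linear part and by `splits` in
      -- the quadratic part.
      cost-completeGVC : ∀ s k → seq (objective GVC completeGVC s) k
        ≡ offset completeGVC k ℚ.+ seq (objective BQP01 B (Inverse.to incidences s)) k
      cost-completeGVC (U₁ , U₂) k = trans (cost-toBQP01 completeGVC (U₁ , U₂) k)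
        (cong (offset completeGVC k ℚ.+_)
          (trans (seq-value (toBQP01 completeGVC) U₁ U₂ k)
          (trans (bilinear-cong
                   (λ i → trans
                     (cong₂ (λ p q → seq (a i) k ℚ.+ p ℚ.+ q) (seq-∑-allFin {n} _ k) (seq-∑-allFin {n} _ k))
                     (cancel-sum (seq (a i) k) (λ j → seq (q⁰ i j) k) (λ j → seq (q¹ i j) k)))
                   (λ j → trans
                     (cong₂ (λ p q → seq (b j) k ℚ.+ p ℚ.+ q) (seq-∑-allFin {m} _ k) (seq-∑-allFin {m} _ k))
                     (cancel-sum (seq (b j) k) (λ i → seq (q⁰ i j) k) (λ i → seq (q¹ i j) k)))
                   (λ i j → trans (ℚ.*-identityˡ _) (splits i j k))
                   (λ i → 𝟙 (does (i ∈? U₁))) (λ j → 𝟙 (does (j ∈? U₂))))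
                 (sym (seq-value B U₁ U₂ k)))))
        where
        open +-*-Solver
        -- The factor `1ℚ` is the edge indicator of the complete graph.
        cancel : ∀ p q → (p ℚ.+ ℚ.- 1ℚ ℚ.* q) ℚ.+ 1ℚ ℚ.* (q ℚ.+ ℚ.- 1ℚ ℚ.* p) ≡ 0ℚ
        cancel = solve 2 (λ p q → let 1# = con 1ℚ; -1# = con (ℚ.- 1ℚ) in
          (p :+ -1# :* q) :+ 1# :* (q :+ -1# :* p) := con 0ℚ) refl
        cancel-sum : ∀ {l} (r : ℚ) (p q : Vector ℚ l) →
          r ℚ.+ sum (λ i → p i ℚ.+ ℚ.- 1ℚ ℚ.* q i) ℚ.+ sum (λ i → 1ℚ ℚ.* (q i ℚ.+ ℚ.- 1ℚ ℚ.* p i)) ≡ r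
        cancel-sum {l} r p q = begin
          r ℚ.+ sum (λ i → p i ℚ.+ ℚ.- 1ℚ ℚ.* q i) ℚ.+ sum (λ i → 1ℚ ℚ.* (q i ℚ.+ ℚ.- 1ℚ ℚ.* p i))
            ≡⟨ ℚ.+-assoc r _ _ ⟩
          r ℚ.+ (sum (λ i → p i ℚ.+ ℚ.- 1ℚ ℚ.* q i) ℚ.+ sum (λ i → 1ℚ ℚ.* (q i ℚ.+ ℚ.- 1ℚ ℚ.* p i)))
            ≡⟨ cong (r ℚ.+_) (∑-distrib-+ (λ i → p i ℚ.+ ℚ.- 1ℚ ℚ.* q i) _) ⟨
          r ℚ.+ sum (λ i → (p i ℚ.+ ℚ.- 1ℚ ℚ.* q i) ℚ.+ 1ℚ ℚ.* (q i ℚ.+ ℚ.- 1ℚ ℚ.* p i))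
            ≡⟨ cong (r ℚ.+_) (sum-cong-≗ λ i → cancel (p i) (q i)) ⟩
          r ℚ.+ sum (replicate l 0ℚ)
            ≡⟨ cong (r ℚ.+_) (sum-replicate-zero l) ⟩
          r ℚ.+ 0ℚ
            ≡⟨ ℚ.+-identityʳ r ⟩
          r ∎
          where open ≡-Reasoning

      completeGVC-optimal : ∀ s → IsOptimal GVC completeGVC s → IsOptimal BQP01 B (Inverse.to incidences s)
      completeGVC-optimal = to-optimal {GVC} {BQP01} incidences completeGVC B (offset completeGVC) cost-completeGVC

-- Special cases of GVC and the equivalences

≃-refl : ∀ x → x ≃ x
≃-refl x ε 0<ε = 0 , λ k _ →
  subst (ℚ._< ε) (sym (cong ℚ.∣_∣ (ℚ.+-inverseʳ (seq x k)))) 0<ε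

module _ {P Q : Problem} {C : ∀ {m n} → Pred (Instance P m n) 0ℓ} where

  -- A special case restricts the instances but keeps solutions and objective, so optimality means
  -- the same in both problems.
  SpecialCase-formulableAs : (decode : ∀ {m n} → Solution Q m n → Solution P m n) →
    FormulableAs P Q decode → FormulableAs (SpecialCase P C) Q decode
  SpecialCase-formulableAs _ P⇒Q I = P⇒Q (proj₁ I)

  -- Forgetting the membership proof leaves the same optimal solutions. This lets the formulation of
  -- BQP01 as GVC2 serve for GVC as well.
  formulableAs-SpecialCase : (decode : ∀ {m n} → Solution P m n → Solution Q m n) →
    FormulableAs Q (SpecialCase P C) decode → FormulableAs Q P decode
  formulableAs-SpecialCase _ Q⇒P I = proj₁ (proj₁ (Q⇒P I)) , proj₂ (Q⇒P I)

  SpecialCase-formulation : ∀ {m n} (decode : Solution P m n → Solution Q m n) (J : Instance Q m n)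
    (I : Instance P m n) → C I → (∀ s → IsOptimal P I s → IsOptimal Q J (decode s)) →
    ∃ λ (I′ : Instance (SpecialCase P C) m n) →
      ∀ s → IsOptimal (SpecialCase P C) I′ s → IsOptimal Q J (decode s)
  SpecialCase-formulation decode J I I∈C optimal = (I , I∈C) , optimal

GVC⇒BQP01 : FormulableAs GVC BQP01 (Inverse.from incidences)
GVC⇒BQP01 I = toBQP01 I , from-optimal {GVC} {BQP01} incidences I (toBQP01 I) (offset I) (cost-toBQP01 I)

-- Names for the predicates inside `GVC1` and `GVC2`, so that `C` can be supplied explicitly.
OnlyQ⁰ OnlyQ² : ∀ {m n} → Pred (GVCInstance m n) 0ℓ
OnlyQ⁰ I = let open GVCInstance I in VanishesOnEdges q¹ × VanishesOnEdges q²
OnlyQ² I = let open GVCInstance I in VanishesOnEdges q⁰ × VanishesOnEdges q¹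

-- With `q¹` and `q²` zero, the combination q⁰ - 2q¹ + q² reduces to `q⁰`, which is therefore taken
-- to be `Q`.
BQP01⇒GVC1 : FormulableAs BQP01 GVC1 (Inverse.to incidences)
BQP01⇒GVC1 B = SpecialCase-formulation {GVC} {BQP01} {OnlyQ⁰} (Inverse.to incidences) B
    (completeGVC B Q (λ _ _ → 0ℝ) (λ _ _ → 0ℝ))
    ((λ _ _ _ → ≃-refl 0ℝ) , (λ _ _ _ → ≃-refl 0ℝ))
    (completeGVC-optimal B Q (λ _ _ → 0ℝ) (λ _ _ → 0ℝ) λ i j k → splits (seq (Q i j) k))
  where
  open BQP01Instance B
  open +-*-Solver
  splits : ∀ q → (q ℚ.+ ℚ.- 1ℚ ℚ.* 0ℚ) ℚ.+ (0ℚ ℚ.+ ℚ.- 1ℚ ℚ.* 0ℚ) ≡ q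
  splits = solve 1 (λ q → let 0# = con 0ℚ; -1# = con (ℚ.- 1ℚ) in
    (q :+ -1# :* 0#) :+ (0# :+ -1# :* 0#) := q) refl

-- Taking `q²` to be `Q` and the other edge weights zero makes the offset and the corrections to `a`
-- and `b` vanish: the product of two bits already marks the edges with both ends chosen.
BQP01⇒GVC2 : FormulableAs BQP01 GVC2 (Inverse.to incidences)
BQP01⇒GVC2 B = SpecialCase-formulation {GVC} {BQP01} {OnlyQ²} (Inverse.to incidences) B
    (completeGVC B (λ _ _ → 0ℝ) (λ _ _ → 0ℝ) Q)
    ((λ _ _ _ → ≃-refl 0ℝ) , (λ _ _ _ → ≃-refl 0ℝ))
    (completeGVC-optimal B (λ _ _ → 0ℝ) (λ _ _ → 0ℝ) Q λ i j k → splits (seq (Q i j) k))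
  where
  open BQP01Instance B
  open +-*-Solver
  splits : ∀ q → (0ℚ ℚ.+ ℚ.- 1ℚ ℚ.* 0ℚ) ℚ.+ (q ℚ.+ ℚ.- 1ℚ ℚ.* 0ℚ) ≡ q
  splits = solve 1 (λ q → let 0# = con 0ℚ; -1# = con (ℚ.- 1ℚ) in
    (0# :+ -1# :* 0#) :+ (q :+ -1# :* 0#) := q) refl

theorem4 : Equivalent GVC  BQP01 incidences
    × Equivalent GVC1 BQP01 incidences
    × Equivalent GVC2 BQP01 incidences
theorem4 = (GVC⇒BQP01 , formulableAs-SpecialCase {GVC} {BQP01} {OnlyQ²} (Inverse.to incidences) BQP01⇒GVC2)
         , (SpecialCase-formulableAs {GVC} {BQP01} {OnlyQ⁰} (Inverse.from incidences) GVC⇒BQP01 , BQP01⇒GVC1)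
         , (SpecialCase-formulableAs {GVC} {BQP01} {OnlyQ²} (Inverse.from incidences) GVC⇒BQP01 , BQP01⇒GVC2)
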